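{- Let $d,n$ be positive integers and $0\le k\le n$ an integer. Then $$\left\langle \begin{matrix} n\\ k\end{matrix}\right\rangle_{d,F}=(-1)^{d\binom{k}{2}}\det\left(\binom{n+d+j-i-1}{n-1}_F\right)_{i,j=0}^{k-1}.$$
   Context: $F_n$ are the Fibonacci numbers ($F_0=0$, $F_1=1$, $F_n=F_{n-1}+F_{n-2}$). Fibonomial coefficients: $\binom{m}{k}_F=\prod_{j=0}^{k-1}\frac{F_{m-j}}{F_{k-j}}$ for $0\le k\le m$, and $0$ if $k<0$ or $k>m$. Fibo-Hoggatt numbers: for $0\le k\le n$, $\left\langle \begin{matrix} n\\ k\end{matrix}\right\rangle_{d,F}=\prod_{j=0}^{k-1}\frac{\binom{n-j+d-1}{d}_F}{\binom{k-j+d-1}{d}_F}$. A $0\times0$ determinant equals $1$. -}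

module Defs where

open import Data.Nat using (ℕ; zero; suc; _∸_) renaming (_+_ to _+ℕ_; _*_ to _*ℕ_)
open import Data.Nat.Combinatorics using (_C_)
open import Data.Fin using (Fin; zero; suc; punchIn; toℕ)
open import Data.Integer using (+_)
open import Data.Rational using (ℚ; 0ℚ; 1ℚ; _+_; _*_; -_; _÷_; ≢-nonZero; _≟_)
open import Relation.Nullary using (yes; no)

F : ℕ → ℕ
F zero = 0
F (suc zero) = 1
F (suc (suc n)) = F (suc n) +ℕ F n

-- Division in ℚ (total: p / 0 := 0; only ever applied to nonzero divisors below)
_/'_ : ℚ → ℚ → ℚ
p /' q with q ≟ 0ℚ
... | yes _ = 0ℚ
... | no q≢0 = _÷_ p q {{≢-nonZero q≢0}}

ℕtoℚ : ℕ → ℚ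
ℕtoℚ n = + n Data.Rational./ 1

prod : ℕ → (ℕ → ℚ) → ℚ
prod zero f = 1ℚ
prod (suc k) f = prod k f * f k

fibonomial : ℕ → ℕ → ℚ
fibonomial m k with k Data.Nat.≤? m
... | yes _ = prod k (λ j → ℕtoℚ (F (m ∸ j)) /' ℕtoℚ (F (k ∸ j)))
... | no _ = 0ℚ

fiboHoggatt : ℕ → ℕ → ℕ → ℚ
fiboHoggatt d n k =
  prod k (λ j → fibonomial ((n ∸ j) +ℕ d ∸ 1) d /' fibonomial ((k ∸ j) +ℕ d ∸ 1) d)

sumFin : ∀ n → (Fin n → ℚ) → ℚ
sumFin zero f = 0ℚ
sumFin (suc n) f = f zero + sumFin n (λ i → f (suc i))

negOnePow : ℕ → ℚ
negOnePow zero = 1ℚ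
negOnePow (suc m) = - negOnePow m

det : ∀ n → (Fin n → Fin n → ℚ) → ℚ
det zero M = 1ℚ
det (suc n) M =
  sumFin (suc n) (λ j → negOnePow (toℕ j) * (M zero j * det n (λ r c → M (suc r) (punchIn j c))))

{-# OPTIONS --safe #-}

-- Write p ∧ q for the 2 × 2 determinant of two plane vectors. By d'Ocagne's identity F(x − s) is the linear form
-- p ∧ αₛ at p = (F(x), F(x+1)), so with N = n − 1 and x_j = N + d + j the (i , j) entry of the matrix is, up to
-- the Fibonacci factorial of N, the product of p_j ∧ αₛ over the window i ≤ s < i + N. After the factors
-- m ≤ s < N common to column j are removed (m = k − 1), what is left is a homogeneous form of Krattenthaler's
-- determinant, ∏_{i≤s<m} (p_j ∧ a_s) ∏_{s<i} (p_j ∧ b_s), with value ∏_{j<l} (p_j ∧ p_l) ∏_{i≤s<m} (a_s ∧ b_i):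
-- expansion along row 0 reduces it to Lagrange interpolation, which follows from the Plücker relation.
-- All the products are then quotients of Fibonacci factorials.
module Submission where

open import Defs
open import Data.Nat using (ℕ; zero; suc; _≤_; _<_; _∸_; NonZero; s≤s) renaming (_+_ to _+ℕ_; _*_ to _*ℕ_)
import Data.Nat as ℕ
import Data.Nat.Properties as ℕ
open import Data.Nat.Combinatorics using (_C_; nC1≡n; nCk+nC[k+1]≡[n+1]C[k+1])
open import Data.Fin using (Fin; zero; suc; toℕ; punchIn)
open import Data.Fin.Properties using (toℕ≤pred[n])
import Data.Integer as ℤ
import Data.Integer.Properties as ℤ
open import Data.Product using (_×_; _,_)
open import Data.Sum using (inj₁; inj₂)
open import Data.Rational using (ℚ; 0ℚ; 1ℚ; _+_; _*_; _-_; -_; 1/_; _≟_; ≢-nonZero)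
open import Data.Rational.Properties
open import Data.Rational.Solver using (module +-*-Solver)
import Data.Rational.Unnormalised as ℚᵘ
import Data.Rational.Unnormalised.Properties as ℚᵘ
open import Function using (_∘_)
open import Relation.Binary.PropositionalEquality using (_≡_; _≢_; refl; sym; trans; cong; cong₂; subst; module ≡-Reasoning)
open import Relation.Nullary using (yes; no; contradiction)

open +-*-Solver using (solve; con; _:+_; _:*_; _:-_; :-_; _:=_)
open ≡-Reasoning

-- Finite products, alternating sums and row expansion of determinants.

prodFin : ∀ n → (Fin n → ℚ) → ℚ
prodFin zero f = 1ℚ
prodFin (suc n) f = f zero * prodFin n (f ∘ suc)

prodFin-cong : ∀ n {f g : Fin n → ℚ} → (∀ i → f i ≡ g i) → prodFin n f ≡ prodFin n g
prodFin-cong zero f≗g = refl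
prodFin-cong (suc n) f≗g = cong₂ _*_ (f≗g zero) (prodFin-cong n (f≗g ∘ suc))

prodFin-* : ∀ n (f g : Fin n → ℚ) → prodFin n (λ i → f i * g i) ≡ prodFin n f * prodFin n g
prodFin-* zero f g = refl
prodFin-* (suc n) f g = begin
  f zero * g zero * prodFin n (λ i → f (suc i) * g (suc i))
    ≡⟨ cong (f zero * g zero *_) (prodFin-* n (f ∘ suc) (g ∘ suc)) ⟩
  f zero * g zero * (prodFin n (f ∘ suc) * prodFin n (g ∘ suc))
    ≡⟨ solve 4 (λ a b c d → a :* b :* (c :* d) := a :* c :* (b :* d)) refl
         (f zero) (g zero) (prodFin n (f ∘ suc)) (prodFin n (g ∘ suc)) ⟩
  f zero * prodFin n (f ∘ suc) * (g zero * prodFin n (g ∘ suc)) ∎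

prodFin-punchIn : ∀ n (f : Fin (suc n) → ℚ) j →
  prodFin (suc n) f ≡ f j * prodFin n (f ∘ punchIn j)
prodFin-punchIn n f zero = refl
prodFin-punchIn (suc n) f (suc j) = begin
  f zero * prodFin (suc n) (f ∘ suc)
    ≡⟨ cong (f zero *_) (prodFin-punchIn n (f ∘ suc) j) ⟩
  f zero * (f (suc j) * prodFin n (f ∘ suc ∘ punchIn j))
    ≡⟨ solve 3 (λ a b c → a :* (b :* c) := b :* (a :* c)) refl
         (f zero) (f (suc j)) (prodFin n (f ∘ suc ∘ punchIn j)) ⟩
  f (suc j) * (f zero * prodFin n (f ∘ suc ∘ punchIn j)) ∎

-- The nested subtraction carries the alternating signs, so inductions over the points need no
-- explicit powers of -1.
altSum : ∀ n → (Fin n → ℚ) → ℚ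
altSum zero f = 0ℚ
altSum (suc n) f = f zero - altSum n (f ∘ suc)

altSum-cong : ∀ n {f g : Fin n → ℚ} → (∀ i → f i ≡ g i) → altSum n f ≡ altSum n g
altSum-cong zero f≗g = refl
altSum-cong (suc n) f≗g = cong₂ _-_ (f≗g zero) (altSum-cong n (f≗g ∘ suc))

altSum-linear : ∀ n c d (f g : Fin n → ℚ) →
  altSum n (λ i → c * f i - d * g i) ≡ c * altSum n f - d * altSum n g
altSum-linear zero c d f g = solve 2 (λ c d → con 0ℚ := c :* con 0ℚ :- d :* con 0ℚ) refl c d
altSum-linear (suc n) c d f g = begin
  c * f zero - d * g zero - altSum n (λ i → c * f (suc i) - d * g (suc i))
    ≡⟨ cong (λ z → c * f zero - d * g zero - z) (altSum-linear n c d (f ∘ suc) (g ∘ suc)) ⟩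
  c * f zero - d * g zero - (c * altSum n (f ∘ suc) - d * altSum n (g ∘ suc))
    ≡⟨ solve 6 (λ c d x y s t →
         c :* x :- d :* y :- (c :* s :- d :* t) := c :* (x :- s) :- d :* (y :- t)) refl
         c d (f zero) (g zero) (altSum n (f ∘ suc)) (altSum n (g ∘ suc)) ⟩
  c * (f zero - altSum n (f ∘ suc)) - d * (g zero - altSum n (g ∘ suc)) ∎

altSum-*ˡ : ∀ n c (f : Fin n → ℚ) → altSum n (λ i → c * f i) ≡ c * altSum n f
altSum-*ˡ zero c f = sym (*-zeroʳ c)
altSum-*ˡ (suc n) c f = begin
  c * f zero - altSum n (λ i → c * f (suc i))
    ≡⟨ cong (λ z → c * f zero - z) (altSum-*ˡ n c (f ∘ suc)) ⟩
  c * f zero - c * altSum n (f ∘ suc)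
    ≡⟨ solve 3 (λ c x s → c :* x :- c :* s := c :* (x :- s)) refl c (f zero) (altSum n (f ∘ suc)) ⟩
  c * (f zero - altSum n (f ∘ suc)) ∎

sumFin-cong : ∀ n {f g : Fin n → ℚ} → (∀ i → f i ≡ g i) → sumFin n f ≡ sumFin n g
sumFin-cong zero f≗g = refl
sumFin-cong (suc n) f≗g = cong₂ _+_ (f≗g zero) (sumFin-cong n (f≗g ∘ suc))

sumFin-neg : ∀ n (f : Fin n → ℚ) → sumFin n (λ i → - f i) ≡ - sumFin n f
sumFin-neg zero f = refl
sumFin-neg (suc n) f =
  trans (cong (- f zero +_) (sumFin-neg n (f ∘ suc))) (sym (neg-distrib-+ (f zero) _))

sumFin-sign≡altSum : ∀ n (f : Fin n → ℚ) → sumFin n (λ j → negOnePow (toℕ j) * f j) ≡ altSum n f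
sumFin-sign≡altSum zero f = refl
sumFin-sign≡altSum (suc n) f = cong₂ _+_ (*-identityˡ (f zero)) (begin
  sumFin n (λ j → - negOnePow (toℕ j) * f (suc j))
    ≡⟨ sumFin-cong n (λ j → sym (neg-distribˡ-* (negOnePow (toℕ j)) (f (suc j)))) ⟩
  sumFin n (λ j → - (negOnePow (toℕ j) * f (suc j)))
    ≡⟨ sumFin-neg n (λ j → negOnePow (toℕ j) * f (suc j)) ⟩
  - sumFin n (λ j → negOnePow (toℕ j) * f (suc j))
    ≡⟨ cong -_ (sumFin-sign≡altSum n (f ∘ suc)) ⟩
  - altSum n (f ∘ suc) ∎)

det-expand : ∀ n (M : Fin (suc n) → Fin (suc n) → ℚ) →
  det (suc n) M ≡ altSum (suc n) (λ j → M zero j * det n (λ r c → M (suc r) (punchIn j c)))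
det-expand n M =
  sumFin-sign≡altSum (suc n) (λ j → M zero j * det n (λ r c → M (suc r) (punchIn j c)))

det-cong : ∀ n {M N : Fin n → Fin n → ℚ} → (∀ i j → M i j ≡ N i j) → det n M ≡ det n N
det-cong zero M≗N = refl
det-cong (suc n) M≗N = sumFin-cong (suc n) λ j →
  cong (negOnePow (toℕ j) *_)
    (cong₂ _*_ (M≗N zero j) (det-cong n (λ r c → M≗N (suc r) (punchIn j c))))

-- In each term of the row expansion the scalar of the deleted column and those of the minor
-- multiply to the full product.
det-scaleColumns : ∀ n (g : Fin n → ℚ) (M : Fin n → Fin n → ℚ) →
  det n (λ i j → g j * M i j) ≡ prodFin n g * det n M
det-scaleColumns zero g M = refl
det-scaleColumns (suc n) g M = begin
  det (suc n) (λ i j → g j * M i j)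
    ≡⟨ det-expand n (λ i j → g j * M i j) ⟩
  altSum (suc n) (λ j → g j * M zero j * det n (λ r c → g (punchIn j c) * M (suc r) (punchIn j c)))
    ≡⟨ altSum-cong (suc n) (λ j → begin
         g j * M zero j * det n (λ r c → g (punchIn j c) * M (suc r) (punchIn j c))
           ≡⟨ cong (g j * M zero j *_) (det-scaleColumns n (g ∘ punchIn j) (λ r c → M (suc r) (punchIn j c))) ⟩
         g j * M zero j * (prodFin n (g ∘ punchIn j) * minor j)
           ≡⟨ solve 4 (λ a b c d → a :* b :* (c :* d) := a :* c :* (b :* d)) refl
                (g j) (M zero j) (prodFin n (g ∘ punchIn j)) (minor j) ⟩
         g j * prodFin n (g ∘ punchIn j) * (M zero j * minor j)
           ≡⟨ cong (_* (M zero j * minor j)) (sym (prodFin-punchIn n g j)) ⟩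
         prodFin (suc n) g * (M zero j * minor j) ∎) ⟩
  altSum (suc n) (λ j → prodFin (suc n) g * (M zero j * minor j))
    ≡⟨ altSum-*ˡ (suc n) (prodFin (suc n) g) (λ j → M zero j * minor j) ⟩
  prodFin (suc n) g * altSum (suc n) (λ j → M zero j * minor j)
    ≡⟨ cong (prodFin (suc n) g *_) (sym (det-expand n M)) ⟩
  prodFin (suc n) g * det (suc n) M ∎
  where
  minor : Fin (suc n) → ℚ
  minor j = det n (λ r c → M (suc r) (punchIn j c))

-- Plücker relations and homogeneous Lagrange interpolation.

infix 8 _∧_

_∧_ : ℚ × ℚ → ℚ × ℚ → ℚ
(a , b) ∧ (c , d) = a * d - b * c

-- The three-term relation between four plane vectors, arranged for the interpolation sum;
-- `plücker′` is the arrangement for the vanishing sum.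
plücker : ∀ p q a b → (q ∧ a) * (p ∧ b) ≡ (p ∧ a) * (q ∧ b) - (p ∧ q) * (a ∧ b)
plücker (p₁ , p₂) (q₁ , q₂) (a₁ , a₂) (b₁ , b₂) =
  solve 8 (λ p₁ p₂ q₁ q₂ a₁ a₂ b₁ b₂ →
      (q₁ :* a₂ :- q₂ :* a₁) :* (p₁ :* b₂ :- p₂ :* b₁)
        := (p₁ :* a₂ :- p₂ :* a₁) :* (q₁ :* b₂ :- q₂ :* b₁)
             :- (p₁ :* q₂ :- p₂ :* q₁) :* (a₁ :* b₂ :- a₂ :* b₁))
    refl p₁ p₂ q₁ q₂ a₁ a₂ b₁ b₂

plücker′ : ∀ r a u v → (r ∧ a) * (u ∧ v) ≡ (v ∧ a) * (u ∧ r) - (u ∧ a) * (v ∧ r)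
plücker′ (r₁ , r₂) (a₁ , a₂) (u₁ , u₂) (v₁ , v₂) =
  solve 8 (λ r₁ r₂ a₁ a₂ u₁ u₂ v₁ v₂ →
      (r₁ :* a₂ :- r₂ :* a₁) :* (u₁ :* v₂ :- u₂ :* v₁)
        := (v₁ :* a₂ :- v₂ :* a₁) :* (u₁ :* r₂ :- u₂ :* r₁)
             :- (u₁ :* a₂ :- u₂ :* a₁) :* (v₁ :* r₂ :- v₂ :* r₁))
    refl r₁ r₂ a₁ a₂ u₁ u₂ v₁ v₂

-- The homogeneous Vandermonde product: for points `(1 , x)` a factor is a difference of two values
-- of `x`.
vandermonde : ∀ n → (Fin n → ℚ × ℚ) → ℚ
vandermonde zero p = 1ℚ
vandermonde (suc n) p = prodFin n (λ l → p zero ∧ p (suc l)) * vandermonde n (p ∘ suc)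

linearForms : ℕ → (ℕ → ℚ × ℚ) → ℚ × ℚ → ℚ
linearForms m a p = prod m (λ s → p ∧ a s)

-- The top divided difference on m + 2 points kills forms of degree m.
altSum-vandermonde≡0 : ∀ m (a : ℕ → ℚ × ℚ) (p : Fin (suc (suc m)) → ℚ × ℚ) →
  altSum (suc (suc m)) (λ j → linearForms m a (p j) * vandermonde (suc m) (p ∘ punchIn j)) ≡ 0ℚ
altSum-vandermonde≡0 zero a p = refl
altSum-vandermonde≡0 (suc m) a p = begin
  f u * (u ∧ A) * (πv * W) - (f v * (v ∧ A) * (πu * W) - altSum (suc m) t)
    ≡⟨ cong (λ z → f u * (u ∧ A) * (πv * W) - (f v * (v ∧ A) * (πu * W) - z))
         (trans (altSum-cong (suc m) term)
                (altSum-linear (suc m) ((v ∧ A) * πu) ((u ∧ A) * πv) zv zu)) ⟩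
  f u * (u ∧ A) * (πv * W) - (f v * (v ∧ A) * (πu * W)
    - ((v ∧ A) * πu * altSum (suc m) zv - (u ∧ A) * πv * altSum (suc m) zu))
    ≡⟨ solve 9 (λ fu uA πv W fv vA πu sv su →
          fu :* uA :* (πv :* W) :- (fv :* vA :* (πu :* W) :- (vA :* πu :* sv :- uA :* πv :* su))
            := uA :* πv :* (fu :* W :- su) :- vA :* πu :* (fv :* W :- sv)) refl
          (f u) (u ∧ A) πv W (f v) (v ∧ A) πu (altSum (suc m) zv) (altSum (suc m) zu) ⟩
  (u ∧ A) * πv * (f u * W - altSum (suc m) zu) - (v ∧ A) * πu * (f v * W - altSum (suc m) zv)
    -- The brackets are the alternating sums for one form fewer, over the points without `v` and
    -- without `u`.
    ≡⟨ cong₂ (λ y z → (u ∧ A) * πv * y - (v ∧ A) * πu * z)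
         (altSum-vandermonde≡0 m a (p ∘ punchIn (suc zero)))
         (altSum-vandermonde≡0 m a (p ∘ suc)) ⟩
  (u ∧ A) * πv * 0ℚ - (v ∧ A) * πu * 0ℚ
    ≡⟨ solve 2 (λ x y → x :* con 0ℚ :- y :* con 0ℚ := con 0ℚ) refl ((u ∧ A) * πv) ((v ∧ A) * πu) ⟩
  0ℚ ∎
  where
  u v A : ℚ × ℚ
  u = p zero
  v = p (suc zero)
  A = a m
  r : Fin (suc m) → ℚ × ℚ
  r j = p (suc (suc j))
  f : ℚ × ℚ → ℚ
  f = linearForms m a
  πu πv W : ℚ
  πu = prodFin (suc m) (λ l → u ∧ r l)
  πv = prodFin (suc m) (λ l → v ∧ r l)
  W = vandermonde (suc m) r
  ρ : ℚ × ℚ → Fin (suc m) → ℚ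
  ρ w j = prodFin m (λ l → w ∧ r (punchIn j l))
  W′ t zu zv : Fin (suc m) → ℚ
  W′ j = vandermonde m (r ∘ punchIn j)
  t j = f (r j) * (r j ∧ A) * ((u ∧ v) * ρ u j * (ρ v j * W′ j))
  zu j = f (r j) * (ρ u j * W′ j)
  zv j = f (r j) * (ρ v j * W′ j)
  term : ∀ j → t j ≡ (v ∧ A) * πu * zv j - (u ∧ A) * πv * zu j
  term j = begin
    t j
      ≡⟨ solve 6 (λ F X Y a b c → F :* X :* (Y :* a :* (b :* c)) := X :* Y :* (F :* a :* b :* c)) refl
           (f (r j)) (r j ∧ A) (u ∧ v) (ρ u j) (ρ v j) (W′ j) ⟩
    -- The relation trades `u ∧ v` for the factor `u ∧ r j` or `v ∧ r j` missing from `ρ u j` or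
    -- `ρ v j`; the completed products `πu` and `πv` no longer depend on `j`.
    (r j ∧ A) * (u ∧ v) * (f (r j) * ρ u j * ρ v j * W′ j)
      ≡⟨ cong (_* (f (r j) * ρ u j * ρ v j * W′ j)) (plücker′ (r j) A u v) ⟩
    ((v ∧ A) * (u ∧ r j) - (u ∧ A) * (v ∧ r j)) * (f (r j) * ρ u j * ρ v j * W′ j)
      ≡⟨ solve 8 (λ vA ur uA vr F a b c →
           (vA :* ur :- uA :* vr) :* (F :* a :* b :* c)
             := vA :* (ur :* a) :* (F :* (b :* c)) :- uA :* (vr :* b) :* (F :* (a :* c))) refl
           (v ∧ A) (u ∧ r j) (u ∧ A) (v ∧ r j) (f (r j)) (ρ u j) (ρ v j) (W′ j) ⟩
    (v ∧ A) * ((u ∧ r j) * ρ u j) * zv j - (u ∧ A) * ((v ∧ r j) * ρ v j) * zu j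
      ≡⟨ cong₂ (λ y z → (v ∧ A) * y * zv j - (u ∧ A) * z * zu j)
           (sym (prodFin-punchIn m (λ l → u ∧ r l) j))
           (sym (prodFin-punchIn m (λ l → v ∧ r l) j)) ⟩
    (v ∧ A) * πu * zv j - (u ∧ A) * πv * zu j ∎

-- Interpolation at b, through the points p, of the product of the forms a, with denominators cleared.
lagrange-interpolation : ∀ m (a : ℕ → ℚ × ℚ) (b : ℚ × ℚ) (p : Fin (suc m) → ℚ × ℚ) →
  altSum (suc m) (λ j → linearForms m a (p j)
      * (prodFin m (λ l → p (punchIn j l) ∧ b) * vandermonde m (p ∘ punchIn j)))
    ≡ vandermonde (suc m) p * prod m (λ s → a s ∧ b)
lagrange-interpolation zero a b p = refl
lagrange-interpolation (suc m) a b p = begin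
  f u * (u ∧ A) * (πb * W) - altSum (suc m) t
    ≡⟨ cong (λ z → f u * (u ∧ A) * (πb * W) - z)
         (trans (altSum-cong (suc m) term)
                (altSum-linear (suc m) ((u ∧ A) * πb) ((A ∧ b) * πu) z s)) ⟩
  f u * (u ∧ A) * (πb * W) - ((u ∧ A) * πb * altSum (suc m) z - (A ∧ b) * πu * altSum (suc m) s)
    ≡⟨ solve 8 (λ fu uA πb W Ab πu z s →
         fu :* uA :* (πb :* W) :- (uA :* πb :* z :- Ab :* πu :* s)
           := uA :* πb :* (fu :* W :- z) :+ Ab :* πu :* s) refl
         (f u) (u ∧ A) πb W (A ∧ b) πu (altSum (suc m) z) (altSum (suc m) s) ⟩
  (u ∧ A) * πb * (f u * W - altSum (suc m) z) + (A ∧ b) * πu * altSum (suc m) s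
    -- The bracket is a top divided difference over all the points; the other sum is the
    -- interpolation without the point `u` and the form `A`.
    ≡⟨ cong₂ (λ y z → (u ∧ A) * πb * y + (A ∧ b) * πu * z)
         (altSum-vandermonde≡0 m a p) (lagrange-interpolation m a b q) ⟩
  (u ∧ A) * πb * 0ℚ + (A ∧ b) * πu * (W * prod m (λ s → a s ∧ b))
    ≡⟨ solve 5 (λ x Ab πu W c → x :* con 0ℚ :+ Ab :* πu :* (W :* c) := πu :* W :* (c :* Ab)) refl
         ((u ∧ A) * πb) (A ∧ b) πu W (prod m (λ s → a s ∧ b)) ⟩
  πu * W * (prod m (λ s → a s ∧ b) * (A ∧ b)) ∎
  where
  u A : ℚ × ℚ
  u = p zero
  A = a m
  q : Fin (suc m) → ℚ × ℚ
  q = p ∘ suc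
  f : ℚ × ℚ → ℚ
  f = linearForms m a
  πu πb W : ℚ
  πu = prodFin (suc m) (λ l → u ∧ q l)
  πb = prodFin (suc m) (λ l → q l ∧ b)
  W = vandermonde (suc m) q
  ρu ρb W′ t z s : Fin (suc m) → ℚ
  ρu j = prodFin m (λ l → u ∧ q (punchIn j l))
  ρb j = prodFin m (λ l → q (punchIn j l) ∧ b)
  W′ j = vandermonde m (q ∘ punchIn j)
  t j = f (q j) * (q j ∧ A) * ((u ∧ b) * ρb j * (ρu j * W′ j))
  z j = f (q j) * (ρu j * W′ j)
  s j = f (q j) * (ρb j * W′ j)
  term : ∀ j → t j ≡ (u ∧ A) * πb * z j - (A ∧ b) * πu * s j
  term j = begin
    t j
      ≡⟨ solve 6 (λ F X Y a b c → F :* X :* (Y :* a :* (b :* c)) := X :* Y :* (F :* a :* b :* c)) refl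
           (f (q j)) (q j ∧ A) (u ∧ b) (ρb j) (ρu j) (W′ j) ⟩
    (q j ∧ A) * (u ∧ b) * (f (q j) * ρb j * ρu j * W′ j)
      ≡⟨ cong (_* (f (q j) * ρb j * ρu j * W′ j)) (plücker u (q j) A b) ⟩
    ((u ∧ A) * (q j ∧ b) - (u ∧ q j) * (A ∧ b)) * (f (q j) * ρb j * ρu j * W′ j)
      ≡⟨ solve 8 (λ uA qb uq Ab F b u c →
           (uA :* qb :- uq :* Ab) :* (F :* b :* u :* c)
             := uA :* (qb :* b) :* (F :* (u :* c)) :- Ab :* (uq :* u) :* (F :* (b :* c))) refl
           (u ∧ A) (q j ∧ b) (u ∧ q j) (A ∧ b) (f (q j)) (ρb j) (ρu j) (W′ j) ⟩
    (u ∧ A) * ((q j ∧ b) * ρb j) * z j - (A ∧ b) * ((u ∧ q j) * ρu j) * s j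
      ≡⟨ cong₂ (λ y w → (u ∧ A) * y * z j - (A ∧ b) * w * s j)
           (sym (prodFin-punchIn m (λ l → q l ∧ b) j))
           (sym (prodFin-punchIn m (λ l → u ∧ q l) j)) ⟩
    (u ∧ A) * πb * z j - (A ∧ b) * πu * s j ∎

-- Krattenthaler's determinant.

-- Recursive in the row, so that deleting row 0 leaves matrices of the same kind for the shifted `a`
-- and `b`, with each column scaled by `p ∧ b 0`.
krattenthalerEntry : ∀ m → Fin (suc m) → (a b : ℕ → ℚ × ℚ) → ℚ × ℚ → ℚ
krattenthalerEntry m zero a b p = linearForms m a p
krattenthalerEntry (suc m) (suc i) a b p = (p ∧ b 0) * krattenthalerEntry m i (a ∘ suc) (b ∘ suc) p

krattenthalerFactor : ℕ → (a b : ℕ → ℚ × ℚ) → ℚ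
krattenthalerFactor zero a b = 1ℚ
krattenthalerFactor (suc m) a b =
  prod (suc m) (λ s → a s ∧ b 0) * krattenthalerFactor m (a ∘ suc) (b ∘ suc)

-- By induction every minor of row 0 is its column scalars times a Vandermonde product times the
-- same constant `K`; what remains is the interpolation sum at `b 0`.
krattenthaler : ∀ m (a b : ℕ → ℚ × ℚ) (p : Fin (suc m) → ℚ × ℚ) →
  det (suc m) (λ i j → krattenthalerEntry m i a b (p j))
    ≡ vandermonde (suc m) p * krattenthalerFactor m a b
krattenthaler zero a b p = refl
krattenthaler (suc m) a b p = begin
  det (suc (suc m)) (λ i j → krattenthalerEntry (suc m) i a b (p j))
    ≡⟨ det-expand (suc m) (λ i j → krattenthalerEntry (suc m) i a b (p j)) ⟩
  altSum (suc (suc m)) (λ j → f j * det (suc m) (λ r c →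
      (p (punchIn j c) ∧ b 0) * krattenthalerEntry m r a′ b′ (p (punchIn j c))))
    ≡⟨ altSum-cong (suc (suc m)) (λ j → begin
         f j * det (suc m) (λ r c →
             (p (punchIn j c) ∧ b 0) * krattenthalerEntry m r a′ b′ (p (punchIn j c)))
           ≡⟨ cong (f j *_) (det-scaleColumns (suc m) (λ c → p (punchIn j c) ∧ b 0)
                (λ r c → krattenthalerEntry m r a′ b′ (p (punchIn j c)))) ⟩
         f j * (π j * det (suc m) (λ r c → krattenthalerEntry m r a′ b′ (p (punchIn j c))))
           ≡⟨ cong (λ z → f j * (π j * z)) (krattenthaler m a′ b′ (p ∘ punchIn j)) ⟩
         f j * (π j * (V j * K))
           ≡⟨ solve 4 (λ f π V K → f :* (π :* (V :* K)) := K :* (f :* (π :* V))) refl (f j) (π j) (V j) K ⟩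
         K * (f j * (π j * V j)) ∎) ⟩
  altSum (suc (suc m)) (λ j → K * (f j * (π j * V j)))
    ≡⟨ altSum-*ˡ (suc (suc m)) K (λ j → f j * (π j * V j)) ⟩
  K * altSum (suc (suc m)) (λ j → f j * (π j * V j))
    ≡⟨ cong (K *_) (lagrange-interpolation (suc m) a (b 0) p) ⟩
  K * (vandermonde (suc (suc m)) p * prod (suc m) (λ s → a s ∧ b 0))
    ≡⟨ solve 3 (λ K V P → K :* (V :* P) := V :* (P :* K)) refl
         K (vandermonde (suc (suc m)) p) (prod (suc m) (λ s → a s ∧ b 0)) ⟩
  vandermonde (suc (suc m)) p * (prod (suc m) (λ s → a s ∧ b 0) * K) ∎
  where
  a′ b′ : ℕ → ℚ × ℚ
  a′ = a ∘ suc
  b′ = b ∘ suc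
  K : ℚ
  K = krattenthalerFactor m a′ b′
  f π V : Fin (suc (suc m)) → ℚ
  f j = linearForms (suc m) a (p j)
  π j = prodFin (suc m) (λ l → p (punchIn j l) ∧ b 0)
  V j = vandermonde (suc m) (p ∘ punchIn j)

-- Products over initial segments of ℕ; cancellation and division in ℚ.

prod-cong : ∀ n {f g : ℕ → ℚ} → (∀ i → i < n → f i ≡ g i) → prod n f ≡ prod n g
prod-cong zero f≗g = refl
prod-cong (suc n) f≗g = cong₂ _*_ (prod-cong n (λ i i<n → f≗g i (ℕ.m<n⇒m<1+n i<n))) (f≗g n ℕ.≤-refl)

prod-* : ∀ n (f g : ℕ → ℚ) → prod n (λ i → f i * g i) ≡ prod n f * prod n g
prod-* zero f g = refl
prod-* (suc n) f g = begin
  prod n (λ i → f i * g i) * (f n * g n)  ≡⟨ cong (_* (f n * g n)) (prod-* n f g) ⟩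
  prod n f * prod n g * (f n * g n)
    ≡⟨ solve 4 (λ a b c d → a :* b :* (c :* d) := a :* c :* (b :* d)) refl (prod n f) (prod n g) (f n) (g n) ⟩
  prod n f * f n * (prod n g * g n)  ∎

prod-suc : ∀ n (f : ℕ → ℚ) → prod (suc n) f ≡ f 0 * prod n (f ∘ suc)
prod-suc zero f = *-comm 1ℚ (f 0)
prod-suc (suc n) f = begin
  prod (suc n) f * f (suc n)            ≡⟨ cong (_* f (suc n)) (prod-suc n f) ⟩
  f 0 * prod n (f ∘ suc) * f (suc n)    ≡⟨ *-assoc (f 0) (prod n (f ∘ suc)) (f (suc n)) ⟩
  f 0 * (prod n (f ∘ suc) * f (suc n))  ∎

prod-+ : ∀ m n (f : ℕ → ℚ) → prod (m +ℕ n) f ≡ prod m f * prod n (λ i → f (m +ℕ i))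
prod-+ m zero f = trans (cong (λ k → prod k f) (ℕ.+-identityʳ m)) (sym (*-identityʳ (prod m f)))
prod-+ m (suc n) f = begin
  prod (m +ℕ suc n) f           ≡⟨ cong (λ k → prod k f) (ℕ.+-suc m n) ⟩
  prod (m +ℕ n) f * f (m +ℕ n)  ≡⟨ cong (_* f (m +ℕ n)) (prod-+ m n f) ⟩
  prod m f * prod n (λ i → f (m +ℕ i)) * f (m +ℕ n)
    ≡⟨ *-assoc (prod m f) (prod n (λ i → f (m +ℕ i))) (f (m +ℕ n)) ⟩
  prod m f * prod (suc n) (λ i → f (m +ℕ i))  ∎

prod-reverse : ∀ n (f : ℕ → ℚ) → prod (suc n) f ≡ prod (suc n) (λ i → f (n ∸ i))
prod-reverse zero f = refl
prod-reverse (suc n) f = begin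
  prod (suc (suc n)) f          ≡⟨ prod-suc (suc n) f ⟩
  f 0 * prod (suc n) (f ∘ suc)  ≡⟨ *-comm (f 0) _ ⟩
  prod (suc n) (f ∘ suc) * f 0  ≡⟨ cong (_* f 0) (prod-reverse n (f ∘ suc)) ⟩
  prod (suc n) (λ i → f (suc (n ∸ i))) * f 0
    ≡⟨ cong₂ _*_
         (prod-cong (suc n) (λ i i<1+n → cong f (sym (ℕ.+-∸-assoc 1 (ℕ.s≤s⁻¹ i<1+n)))))
         (cong f (sym (ℕ.n∸n≡0 n))) ⟩
  prod (suc n) (λ i → f (suc n ∸ i)) * f (n ∸ n)  ∎

prod-zero : ∀ n (f : ℕ → ℚ) i → i < n → f i ≡ 0ℚ → prod n f ≡ 0ℚ
prod-zero (suc n) f i i<1+n fi≡0 with i ℕ.≟ n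
... | yes refl = trans (cong (prod n f *_) fi≡0) (*-zeroʳ (prod n f))
... | no i≢n = trans
  (cong (_* f n) (prod-zero n f i (ℕ.≤∧≢⇒< (ℕ.s≤s⁻¹ i<1+n) i≢n) fi≡0)) (*-zeroˡ (f n))

prodFin-toℕ : ∀ n (f : ℕ → ℚ) → prodFin n (f ∘ toℕ) ≡ prod n f
prodFin-toℕ zero f = refl
prodFin-toℕ (suc n) f = trans (cong (f 0 *_) (prodFin-toℕ n (f ∘ suc))) (sym (prod-suc n f))

*-cancelˡ-≢0 : ∀ r {p q} → r ≢ 0ℚ → r * p ≡ r * q → p ≡ q
*-cancelˡ-≢0 r {p} {q} r≢0 rp≡rq = begin
  p              ≡⟨ undo p ⟩
  r⁻¹ * (r * p)  ≡⟨ cong (r⁻¹ *_) rp≡rq ⟩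
  r⁻¹ * (r * q)  ≡⟨ sym (undo q) ⟩
  q              ∎
  where
  r⁻¹ : ℚ
  r⁻¹ = 1/_ r {{≢-nonZero r≢0}}
  undo : ∀ t → t ≡ r⁻¹ * (r * t)
  undo t = begin
    t              ≡⟨ sym (*-identityˡ t) ⟩
    1ℚ * t         ≡⟨ cong (_* t) (sym (*-inverseˡ r {{≢-nonZero r≢0}})) ⟩
    r⁻¹ * r * t    ≡⟨ *-assoc r⁻¹ r t ⟩
    r⁻¹ * (r * t)  ∎

*-≢0 : ∀ {p q} → p ≢ 0ℚ → q ≢ 0ℚ → p * q ≢ 0ℚ
*-≢0 {p} p≢0 q≢0 pq≡0 = q≢0 (*-cancelˡ-≢0 p p≢0 (trans pq≡0 (sym (*-zeroʳ p))))

prod-≢0 : ∀ n {f : ℕ → ℚ} → (∀ i → f i ≢ 0ℚ) → prod n f ≢ 0ℚ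
prod-≢0 zero f≢0 ()
prod-≢0 (suc n) f≢0 = *-≢0 (prod-≢0 n f≢0) (f≢0 n)

/'-*-cancel : ∀ p {q} → q ≢ 0ℚ → (p /' q) * q ≡ p
/'-*-cancel p {q} q≢0 with q ≟ 0ℚ
... | yes q≡0 = contradiction q≡0 q≢0
... | no q≢0′ = begin
  p * 1/q * q    ≡⟨ *-assoc p 1/q q ⟩
  p * (1/q * q)  ≡⟨ cong (p *_) (*-inverseˡ q {{≢-nonZero q≢0′}}) ⟩
  p * 1ℚ         ≡⟨ *-identityʳ p ⟩
  p              ∎
  where
  1/q : ℚ
  1/q = 1/_ q {{≢-nonZero q≢0′}}

-- Quotients enter the argument only cross-multiplied, which leaves ring identities to check.
prod-/' : ∀ n (f g : ℕ → ℚ) → (∀ i → i < n → g i ≢ 0ℚ) →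
  prod n (λ i → f i /' g i) * prod n g ≡ prod n f
prod-/' n f g g≢0 = trans (sym (prod-* n _ g)) (prod-cong n (λ i i<n → /'-*-cancel (f i) (g≢0 i i<n)))

-- Fibonacci numbers, their factorials and fibonomial coefficients in ℚ.

-- Rational arithmetic cancels a gcd, so the equation is checked on unnormalised fractions with
-- denominator 1 (`mkℚᵘ` stores the denominator minus one).
ℕtoℚ-+ : ∀ m n → ℕtoℚ (m +ℕ n) ≡ ℕtoℚ m + ℕtoℚ n
ℕtoℚ-+ m n = toℚᵘ-injective
  (ℚᵘ.≃-trans (toℚᵘ-fromℚᵘ (ι (m +ℕ n)))
  (ℚᵘ.≃-trans (ℚᵘ.*≡* (cong (ℤ._* ℤ.+ 1) (sym (cong₂ ℤ._+_ (ℤ.*-identityʳ (ℤ.+ m)) (ℤ.*-identityʳ (ℤ.+ n))))))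
  (ℚᵘ.≃-trans (ℚᵘ.+-cong (ℚᵘ.≃-sym (toℚᵘ-fromℚᵘ (ι m))) (ℚᵘ.≃-sym (toℚᵘ-fromℚᵘ (ι n))))
    (ℚᵘ.≃-sym (toℚᵘ-homo-+ (ℕtoℚ m) (ℕtoℚ n))))))
  where
  ι : ℕ → ℚᵘ.ℚᵘ
  ι k = ℚᵘ.mkℚᵘ (ℤ.+ k) 0

ℕtoℚ-≢0 : ∀ n .{{_ : NonZero n}} → ℕtoℚ n ≢ 0ℚ
ℕtoℚ-≢0 n n≡0 = <⇒≢ (positive⁻¹ (ℕtoℚ n) {{normalize-pos n 1}}) (sym n≡0)

fib : ℕ → ℚ
fib n = ℕtoℚ (F n)

fib-rec : ∀ n → fib (suc (suc n)) ≡ fib (suc n) + fib n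
fib-rec n = ℕtoℚ-+ (F (suc n)) (F n)

F-suc-nonZero : ∀ n → NonZero (F (suc n))
F-suc-nonZero zero = _
F-suc-nonZero (suc n) = ℕ.>-nonZero (ℕ.<-≤-trans (ℕ.>-nonZero⁻¹ (F (suc n)) {{F-suc-nonZero n}}) (ℕ.m≤m+n (F (suc n)) (F n)))

fib-suc-≢0 : ∀ n → fib (suc n) ≢ 0ℚ
fib-suc-≢0 n = ℕtoℚ-≢0 (F (suc n)) {{F-suc-nonZero n}}

fib! : ℕ → ℚ
fib! n = prod n (λ t → fib (suc t))

fib!-≢0 : ∀ n → fib! n ≢ 0ℚ
fib!-≢0 n = prod-≢0 n fib-suc-≢0

fib!-falling : ∀ r {y} → r ≤ y → prod r (λ t → fib (y ∸ t)) * fib! (y ∸ r) ≡ fib! y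
fib!-falling zero {y} r≤y = *-identityˡ (fib! y)
fib!-falling (suc r) {y} r<y = begin
  Π * fib (y ∸ r) * fib! (y ∸ suc r)
    ≡⟨ solve 3 (λ a b c → a :* b :* c := a :* (c :* b)) refl Π (fib (y ∸ r)) (fib! (y ∸ suc r)) ⟩
  Π * (fib! (y ∸ suc r) * fib (y ∸ r))
    ≡⟨ cong (λ z → Π * (fib! (y ∸ suc r) * fib z)) y∸r≡ ⟩
  Π * fib! (suc (y ∸ suc r))
    ≡⟨ cong (λ z → Π * fib! z) (sym y∸r≡) ⟩
  Π * fib! (y ∸ r)
    ≡⟨ fib!-falling r (ℕ.<⇒≤ r<y) ⟩
  fib! y ∎
  where
  Π : ℚ
  Π = prod r (λ t → fib (y ∸ t))
  y∸r≡ : y ∸ r ≡ suc (y ∸ suc r)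
  y∸r≡ = ℕ.+-∸-assoc 1 r<y

-- Only the denominator is cleared: the falling product is what becomes a product of linear forms in
-- the matrix entries.
fibonomial-≤ : ∀ {m k} → k ≤ m → fibonomial m k * fib! k ≡ prod k (λ t → fib (m ∸ t))
fibonomial-≤ {m} {k} k≤m with k ℕ.≤? m
... | no k≰m = contradiction k≤m k≰m
... | yes _ = begin
  Q * fib! k              ≡⟨ cong (Q *_) (sym (fib!-falling k ℕ.≤-refl)) ⟩
  Q * (D * fib! (k ∸ k))  ≡⟨ cong (λ z → Q * (D * fib! z)) (ℕ.n∸n≡0 k) ⟩
  Q * (D * 1ℚ)            ≡⟨ cong (Q *_) (*-identityʳ D) ⟩
  Q * D                   ≡⟨ prod-/' k (λ t → fib (m ∸ t)) (λ t → fib (k ∸ t))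
                                     (λ t t<k → subst (λ z → fib z ≢ 0ℚ) (sym (ℕ.+-∸-assoc 1 t<k)) (fib-suc-≢0 (k ∸ suc t))) ⟩
  prod k (λ t → fib (m ∸ t))  ∎
  where
  Q D : ℚ
  Q = prod k (λ t → fib (m ∸ t) /' fib (k ∸ t))
  D = prod k (λ t → fib (k ∸ t))

fibonomial-> : ∀ {m k} → m < k → fibonomial m k ≡ 0ℚ
fibonomial-> {m} {k} m<k with k ℕ.≤? m
... | yes k≤m = contradiction k≤m (ℕ.<⇒≱ m<k)
... | no _ = refl

fibonomial-fib! : ∀ y d → fibonomial (y +ℕ d) d * (fib! d * fib! y) ≡ fib! (y +ℕ d)
fibonomial-fib! y d = begin
  b * (fib! d * fib! y)                                ≡⟨ sym (*-assoc b (fib! d) (fib! y)) ⟩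
  b * fib! d * fib! y                                  ≡⟨ cong₂ (λ u v → u * fib! v) (fibonomial-≤ (ℕ.m≤n+m d y)) (sym (ℕ.m+n∸n≡m y d)) ⟩
  prod d (λ t → fib (y +ℕ d ∸ t)) * fib! (y +ℕ d ∸ d)  ≡⟨ fib!-falling d (ℕ.m≤n+m d y) ⟩
  fib! (y +ℕ d)                                        ∎
  where
  b : ℚ
  b = fibonomial (y +ℕ d) d

fibonomial-≢0 : ∀ y d → fibonomial (y +ℕ d) d ≢ 0ℚ
fibonomial-≢0 y d b≡0 = fib!-≢0 (y +ℕ d)
  (trans (sym (fibonomial-fib! y d)) (trans (cong (_* (fib! d * fib! y)) b≡0) (*-zeroˡ (fib! d * fib! y))))

-- Signs.

negOnePow-+ : ∀ m n → negOnePow (m +ℕ n) ≡ negOnePow m * negOnePow n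
negOnePow-+ zero n = sym (*-identityˡ (negOnePow n))
negOnePow-+ (suc m) n = trans (cong -_ (negOnePow-+ m n)) (neg-distribˡ-* (negOnePow m) (negOnePow n))

negOnePow-square : ∀ n → negOnePow n * negOnePow n ≡ 1ℚ
negOnePow-square zero = refl
negOnePow-square (suc n) = trans
  (solve 1 (λ e → (:- e) :* (:- e) := e :* e) refl (negOnePow n)) (negOnePow-square n)

prod-negOnePow : ∀ d n → prod n (λ _ → negOnePow d) ≡ negOnePow (d *ℕ n)
prod-negOnePow d zero = cong negOnePow (sym (ℕ.*-zeroʳ d))
prod-negOnePow d (suc n) = begin
  prod n (λ _ → negOnePow d) * negOnePow d  ≡⟨ cong (_* negOnePow d) (prod-negOnePow d n) ⟩
  negOnePow (d *ℕ n) * negOnePow d          ≡⟨ *-comm (negOnePow (d *ℕ n)) (negOnePow d) ⟩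
  negOnePow d * negOnePow (d *ℕ n)          ≡⟨ sym (negOnePow-+ d (d *ℕ n)) ⟩
  negOnePow (d +ℕ d *ℕ n)                   ≡⟨ cong negOnePow (sym (ℕ.*-suc d n)) ⟩
  negOnePow (d *ℕ suc n)                    ∎

-- The sign of ∏ (-1)^(x + i + 1) over 0 ≤ i < l < k.
staircaseSign : ℕ → ℕ → ℚ
staircaseSign zero x = 1ℚ
staircaseSign (suc m) x = prod m (λ _ → negOnePow (suc x)) * staircaseSign m (suc x)

-- The exponents in corresponding factors differ by `d`, so each of the `k C 2` positions
-- contributes (-1)^d; Pascal's rule counts the positions.
staircaseSign-* : ∀ k x d →
  staircaseSign k (x +ℕ d) * staircaseSign k x ≡ negOnePow (d *ℕ (k C 2))
staircaseSign-* zero x d = cong negOnePow (sym (ℕ.*-zeroʳ d))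
staircaseSign-* (suc m) x d = begin
  prod m ε₁ * S₁ * (prod m ε₀ * S₀)
    ≡⟨ solve 4 (λ a b c d → a :* b :* (c :* d) := a :* c :* (b :* d)) refl (prod m ε₁) S₁ (prod m ε₀) S₀ ⟩
  prod m ε₁ * prod m ε₀ * (S₁ * S₀)
    ≡⟨ cong₂ _*_ (trans (sym (prod-* m ε₁ ε₀)) (prod-cong m (λ i _ → ε₁ε₀≡ i))) (staircaseSign-* m (suc x) d) ⟩
  prod m (λ _ → negOnePow d) * negOnePow (d *ℕ (m C 2))
    ≡⟨ cong (_* negOnePow (d *ℕ (m C 2))) (prod-negOnePow d m) ⟩
  negOnePow (d *ℕ m) * negOnePow (d *ℕ (m C 2))
    ≡⟨ sym (negOnePow-+ (d *ℕ m) (d *ℕ (m C 2))) ⟩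
  negOnePow (d *ℕ m +ℕ d *ℕ (m C 2))
    ≡⟨ cong negOnePow (sym (ℕ.*-distribˡ-+ d m (m C 2))) ⟩
  negOnePow (d *ℕ (m +ℕ (m C 2)))
    ≡⟨ cong (λ z → negOnePow (d *ℕ z))
         (trans (cong (_+ℕ (m C 2)) (sym (nC1≡n m))) (nCk+nC[k+1]≡[n+1]C[k+1] m 1)) ⟩
  negOnePow (d *ℕ (suc m C 2)) ∎
  where
  S₀ S₁ : ℚ
  S₀ = staircaseSign m (suc x)
  S₁ = staircaseSign m (suc x +ℕ d)
  ε₀ ε₁ : ℕ → ℚ
  ε₀ _ = negOnePow (suc x)
  ε₁ _ = negOnePow (suc x +ℕ d)
  ε₁ε₀≡ : ∀ i → ε₁ i * ε₀ i ≡ negOnePow d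
  ε₁ε₀≡ i = begin
    negOnePow (suc x +ℕ d) * e  ≡⟨ cong (_* e) (negOnePow-+ (suc x) d) ⟩
    e * negOnePow d * e         ≡⟨ solve 2 (λ a b → a :* b :* a := a :* a :* b) refl e (negOnePow d) ⟩
    e * e * negOnePow d         ≡⟨ cong (_* negOnePow d) (negOnePow-square (suc x)) ⟩
    1ℚ * negOnePow d            ≡⟨ *-identityˡ (negOnePow d) ⟩
    negOnePow d                 ∎
    where
    e : ℚ
    e = negOnePow (suc x)

-- Fibonacci vectors and d'Ocagne's identity.

P : ℕ → ℚ × ℚ
P x = fib x , fib (suc x)

-- The factor (-1)^s makes P x ∧ α s equal to F(x − s) without a sign.
α : ℕ → ℚ × ℚ
α s = negOnePow s * fib s , negOnePow s * fib (suc s)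

-- Advancing both vectors by one applies the Fibonacci matrix, of determinant -1, and so only flips
-- the sign.
d'Ocagne : ∀ s y → P (s +ℕ y) ∧ P s ≡ negOnePow s * fib y
d'Ocagne zero y = solve 2 (λ a b → a :* con 1ℚ :- b :* con 0ℚ := con 1ℚ :* a) refl (fib y) (fib (suc y))
d'Ocagne (suc s) y = begin
  B * fib (suc (suc s)) - fib (suc (suc (s +ℕ y))) * b
    ≡⟨ cong₂ (λ u v → B * u - v * b) (fib-rec s) (fib-rec (s +ℕ y)) ⟩
  B * (b + a) - (B + A) * b
    ≡⟨ solve 4 (λ A B a b → B :* (b :+ a) :- (B :+ A) :* b := :- (A :* b :- B :* a)) refl A B a b ⟩
  - (A * b - B * a)
    ≡⟨ cong -_ (d'Ocagne s y) ⟩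
  - (negOnePow s * fib y)
    ≡⟨ neg-distribˡ-* (negOnePow s) (fib y) ⟩
  - negOnePow s * fib y ∎
  where
  A B a b : ℚ
  A = fib (s +ℕ y)
  B = fib (suc s +ℕ y)
  a = fib s
  b = fib (suc s)

P∧P : ∀ x y → P x ∧ P (x +ℕ y) ≡ negOnePow (suc x) * fib y
P∧P x y = begin
  fib x * B - fib (suc x) * A  ≡⟨ solve 4 (λ a b A B → a :* B :- b :* A := :- (A :* b :- B :* a)) refl (fib x) (fib (suc x)) A B ⟩
  - (P (x +ℕ y) ∧ P x)         ≡⟨ cong -_ (d'Ocagne x y) ⟩
  - (negOnePow x * fib y)      ≡⟨ neg-distribˡ-* (negOnePow x) (fib y) ⟩
  - negOnePow x * fib y        ∎
  where
  A B : ℚ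
  A = fib (x +ℕ y)
  B = fib (suc x +ℕ y)

P∧α : ∀ {x s} → s ≤ x → P x ∧ α s ≡ fib (x ∸ s)
P∧α {x} {s} s≤x = begin
  P x ∧ α s  ≡⟨ cong (λ z → P z ∧ α s) (sym (ℕ.m+[n∸m]≡n s≤x)) ⟩
  P z ∧ α s
    ≡⟨ solve 5 (λ e A B a b → A :* (e :* b) :- B :* (e :* a) := e :* (A :* b :- B :* a)) refl
         e (fib z) (fib (suc z)) (fib s) (fib (suc s)) ⟩
  e * (P z ∧ P s)        ≡⟨ cong (e *_) (d'Ocagne s (x ∸ s)) ⟩
  e * (e * fib (x ∸ s))  ≡⟨ sym (*-assoc e e (fib (x ∸ s))) ⟩
  e * e * fib (x ∸ s)    ≡⟨ cong (_* fib (x ∸ s)) (negOnePow-square s) ⟩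
  1ℚ * fib (x ∸ s)       ≡⟨ *-identityˡ (fib (x ∸ s)) ⟩
  fib (x ∸ s)            ∎
  where
  z : ℕ
  z = s +ℕ (x ∸ s)
  e : ℚ
  e = negOnePow s

-- The sign in `α s` is absorbed by `P t ∧ α s`. What survives is the sign of the larger index and
-- one from antisymmetry, so for fixed `t` the sign is constant in `s`.
α∧α : ∀ {s t} → s ≤ t → α s ∧ α t ≡ negOnePow (suc t) * fib (t ∸ s)
α∧α {s} {t} s≤t = begin
  α s ∧ α t
    ≡⟨ solve 6 (λ e e′ a b A B →
         e :* a :* (e′ :* B) :- e :* b :* (e′ :* A) := :- e′ :* (A :* (e :* b) :- B :* (e :* a))) refl
         (negOnePow s) (negOnePow t) (fib s) (fib (suc s)) (fib t) (fib (suc t)) ⟩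
  negOnePow (suc t) * (P t ∧ α s)  ≡⟨ cong (negOnePow (suc t) *_) (P∧α s≤t) ⟩
  negOnePow (suc t) * fib (t ∸ s)  ∎

-- The Vandermonde and Krattenthaler factors as Fibonacci factorials.

-- The wedges of the first point with the later ones are F(1), F(2), ... with a common sign. The
-- family `p` is kept general so that its tail fits the induction hypothesis.
vandermonde-P : ∀ k x {p : Fin k → ℚ × ℚ} → (∀ j → p j ≡ P (x +ℕ toℕ j)) →
  vandermonde k p ≡ staircaseSign k x * prod k fib!
vandermonde-P zero x p≗P = refl
vandermonde-P (suc k) x {p} p≗P = begin
  prodFin k (λ l → p zero ∧ p (suc l)) * vandermonde k (p ∘ suc)
    ≡⟨ cong₂ _*_
         (trans (prodFin-cong k row) (trans (prodFin-toℕ k (λ l → e * fib (suc l))) (prod-* k (λ _ → e) (λ l → fib (suc l)))))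
         (vandermonde-P k (suc x) (λ j → trans (p≗P (suc j)) (cong P (ℕ.+-suc x (toℕ j))))) ⟩
  prod k (λ _ → e) * fib! k * (staircaseSign k (suc x) * prod k fib!)
    ≡⟨ solve 4 (λ a b c d → a :* b :* (c :* d) := a :* c :* (d :* b)) refl
         (prod k (λ _ → e)) (fib! k) (staircaseSign k (suc x)) (prod k fib!) ⟩
  staircaseSign (suc k) x * prod (suc k) fib! ∎
  where
  e : ℚ
  e = negOnePow (suc x)
  row : ∀ l → p zero ∧ p (suc l) ≡ e * fib (suc (toℕ l))
  row l = trans (cong₂ _∧_ (trans (p≗P zero) (cong P (ℕ.+-identityʳ x))) (p≗P (suc l))) (P∧P x (suc (toℕ l)))

-- Each step of the recursion yields a falling product from F(D), which one factor `fib! (D ∸ j)`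
-- completes to `fib! D`. The hypothesis on `a` and `b` survives shifting both, with `D` fixed and
-- `x` raised by one.
krattenthalerFactor-fib! : ∀ m D x {a b : ℕ → ℚ × ℚ} → m ≤ D →
  (∀ s t → s ≤ D +ℕ t → a s ∧ b t ≡ negOnePow (suc (x +ℕ t)) * fib (D +ℕ t ∸ s)) →
  krattenthalerFactor m a b * prod (suc m) (λ j → fib! (D ∸ j))
    ≡ staircaseSign (suc m) x * prod (suc m) (λ _ → fib! D)
krattenthalerFactor-fib! zero D x m≤D a∧b≡ = refl
krattenthalerFactor-fib! (suc m) D x {a} {b} m<D a∧b≡ = begin
  prod (suc m) (λ s → a s ∧ b 0) * K * (Π * fib! (D ∸ suc m))
    ≡⟨ cong (λ z → z * K * (Π * fib! (D ∸ suc m)))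
         (trans (prod-cong (suc m) row) (prod-* (suc m) (λ _ → e) (λ s → fib (D ∸ s)))) ⟩
  E * G * K * (Π * fib! (D ∸ suc m))
    ≡⟨ solve 5 (λ E G K Π p → E :* G :* K :* (Π :* p) := E :* (K :* Π) :* (G :* p)) refl
         E G K Π (fib! (D ∸ suc m)) ⟩
  E * (K * Π) * (G * fib! (D ∸ suc m))
    ≡⟨ cong₂ (λ y z → E * y * z)
         (krattenthalerFactor-fib! m D (suc x) (ℕ.<⇒≤ m<D) shifted)
         (fib!-falling (suc m) m<D) ⟩
  E * (staircaseSign (suc m) (suc x) * prod (suc m) (λ _ → fib! D)) * fib! D
    ≡⟨ solve 4 (λ E s p q → E :* (s :* p) :* q := E :* s :* (p :* q)) refl
         E (staircaseSign (suc m) (suc x)) (prod (suc m) (λ _ → fib! D)) (fib! D) ⟩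
  E * staircaseSign (suc m) (suc x) * (prod (suc m) (λ _ → fib! D) * fib! D) ∎
  where
  e E G K Π : ℚ
  e = negOnePow (suc x)
  E = prod (suc m) (λ _ → e)
  G = prod (suc m) (λ s → fib (D ∸ s))
  K = krattenthalerFactor m (a ∘ suc) (b ∘ suc)
  Π = prod (suc m) (λ j → fib! (D ∸ j))
  row : ∀ s → s < suc m → a s ∧ b 0 ≡ e * fib (D ∸ s)
  row s s≤m = trans
    (a∧b≡ s 0 (subst (s ≤_) (sym (ℕ.+-identityʳ D)) (ℕ.≤-trans (ℕ.<⇒≤ s≤m) m<D)))
    (cong₂ (λ y z → negOnePow (suc y) * fib (z ∸ s)) (ℕ.+-identityʳ x) (ℕ.+-identityʳ D))
  shifted : ∀ s t → s ≤ D +ℕ t →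
    a (suc s) ∧ b (suc t) ≡ negOnePow (suc (suc x +ℕ t)) * fib (D +ℕ t ∸ s)
  shifted s t s≤D+t = trans
    (a∧b≡ (suc s) (suc t) (subst (suc s ≤_) (sym (ℕ.+-suc D t)) (s≤s s≤D+t)))
    (cong₂ (λ y z → negOnePow (suc y) * fib (z ∸ suc s)) (ℕ.+-suc x t) (ℕ.+-suc D t))

-- Matrix entries as products of linear forms over a window.

krattenthalerEntry-prod : ∀ m (i : Fin (suc m)) (a b : ℕ → ℚ × ℚ) p →
  krattenthalerEntry m i a b p
    ≡ prod (m ∸ toℕ i) (λ s → p ∧ a (toℕ i +ℕ s)) * prod (toℕ i) (λ s → p ∧ b s)
krattenthalerEntry-prod m zero a b p = sym (*-identityʳ (linearForms m a p))
krattenthalerEntry-prod (suc m) (suc i) a b p = begin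
  (p ∧ b 0) * krattenthalerEntry m i (a ∘ suc) (b ∘ suc) p
    ≡⟨ cong ((p ∧ b 0) *_) (krattenthalerEntry-prod m i (a ∘ suc) (b ∘ suc) p) ⟩
  (p ∧ b 0) * (A * B)
    ≡⟨ solve 3 (λ x A B → x :* (A :* B) := A :* (x :* B)) refl (p ∧ b 0) A B ⟩
  A * ((p ∧ b 0) * B)
    ≡⟨ cong (A *_) (sym (prod-suc (toℕ i) (λ s → p ∧ b s))) ⟩
  A * prod (suc (toℕ i)) (λ s → p ∧ b s) ∎
  where
  A B : ℚ
  A = prod (m ∸ toℕ i) (λ s → p ∧ a (suc (toℕ i +ℕ s)))
  B = prod (toℕ i) (λ s → p ∧ b (suc s))

-- Taking for `b` the continuation of `a` from index m + r on, the ranges [i, m), [m, m + r) and [m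
-- + r, m + r + i) join into one window. The middle range does not depend on `i` and is the factor
-- common to the column.
krattenthalerEntry-window : ∀ m r (i : Fin (suc m)) (a : ℕ → ℚ × ℚ) p →
  prod r (λ t → p ∧ a (m +ℕ t)) * krattenthalerEntry m i a (λ s → a (m +ℕ r +ℕ s)) p
    ≡ prod (m +ℕ r) (λ t → p ∧ a (toℕ i +ℕ t))
krattenthalerEntry-window m r i a p = begin
  prod r (λ t → p ∧ a (m +ℕ t)) * krattenthalerEntry m i a (λ s → a (m +ℕ r +ℕ s)) p
    ≡⟨ cong (prod r (λ t → p ∧ a (m +ℕ t)) *_) (krattenthalerEntry-prod m i a (λ s → a (m +ℕ r +ℕ s)) p) ⟩
  prod r (λ t → p ∧ a (m +ℕ t)) * (prod u g * prod ι (λ s → p ∧ a (m +ℕ r +ℕ s)))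
    ≡⟨ cong₂ (λ y z → y * (prod u g * z))
         (prod-cong r (λ t _ → cong (λ z → p ∧ a z) (middle t)))
         (prod-cong ι (λ s _ → cong (λ z → p ∧ a z) (trans (ℕ.+-assoc m r s) (middle (r +ℕ s))))) ⟩
  prod r (λ t → g (u +ℕ t)) * (prod u g * prod ι (λ s → g (u +ℕ (r +ℕ s))))
    ≡⟨ solve 3 (λ x y z → x :* (y :* z) := y :* (x :* z)) refl
         (prod r (λ t → g (u +ℕ t))) (prod u g) (prod ι (λ s → g (u +ℕ (r +ℕ s)))) ⟩
  prod u g * (prod r (λ t → g (u +ℕ t)) * prod ι (λ s → g (u +ℕ (r +ℕ s))))
    ≡⟨ cong (prod u g *_) (sym (prod-+ r ι (λ t → g (u +ℕ t)))) ⟩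
  prod u g * prod (r +ℕ ι) (λ t → g (u +ℕ t))
    ≡⟨ sym (prod-+ u (r +ℕ ι) g) ⟩
  prod (u +ℕ (r +ℕ ι)) g
    ≡⟨ cong (λ z → prod z g) size ⟩
  prod (m +ℕ r) g ∎
  where
  ι u : ℕ
  ι = toℕ i
  u = m ∸ ι
  ι+u≡m : ι +ℕ u ≡ m
  ι+u≡m = ℕ.m+[n∸m]≡n (toℕ≤pred[n] i)
  g : ℕ → ℚ
  g t = p ∧ a (ι +ℕ t)
  middle : ∀ t → m +ℕ t ≡ ι +ℕ (u +ℕ t)
  middle t = trans (cong (_+ℕ t) (sym ι+u≡m)) (ℕ.+-assoc ι u t)
  size : u +ℕ (r +ℕ ι) ≡ m +ℕ r
  size = trans (cong (u +ℕ_) (ℕ.+-comm r ι))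
    (trans (sym (ℕ.+-assoc u ι r)) (cong (_+ℕ r) (trans (ℕ.+-comm u ι) ι+u≡m)))

-- Holds also for the entries that are 0 by definition, since the product of forms then vanishes
-- too; all entries thus get the same shape.
fibonomial-linearForms : ∀ {x i} N → i ≤ x →
  fib! N * fibonomial (x ∸ i) N ≡ prod N (λ t → P x ∧ α (i +ℕ t))
fibonomial-linearForms {x} {i} N i≤x with ℕ.≤-<-connex N (x ∸ i)
... | inj₁ N≤x∸i = begin
  fib! N * fibonomial (x ∸ i) N    ≡⟨ *-comm (fib! N) (fibonomial (x ∸ i) N) ⟩
  fibonomial (x ∸ i) N * fib! N    ≡⟨ fibonomial-≤ N≤x∸i ⟩
  prod N (λ t → fib (x ∸ i ∸ t))   ≡⟨ prod-cong N (λ t t<N → trans (cong fib (ℕ.∸-+-assoc x i t)) (sym (P∧α (i+t≤x t<N)))) ⟩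
  prod N (λ t → P x ∧ α (i +ℕ t))  ∎
  where
  i+t≤x : ∀ {t} → t < N → i +ℕ t ≤ x
  i+t≤x t<N = subst (_ ≤_) (ℕ.m+[n∸m]≡n i≤x) (ℕ.+-monoʳ-≤ i (ℕ.≤-trans (ℕ.<⇒≤ t<N) N≤x∸i))
-- The window then contains s = x, where P x ∧ α x = F(0).
... | inj₂ x∸i<N = begin
  fib! N * fibonomial (x ∸ i) N    ≡⟨ cong (fib! N *_) (fibonomial-> x∸i<N) ⟩
  fib! N * 0ℚ                      ≡⟨ *-zeroʳ (fib! N) ⟩
  0ℚ                               ≡⟨ sym (prod-zero N (λ t → P x ∧ α (i +ℕ t)) (x ∸ i) x∸i<N vanishes) ⟩
  prod N (λ t → P x ∧ α (i +ℕ t))  ∎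
  where
  vanishes : P x ∧ α (i +ℕ (x ∸ i)) ≡ 0ℚ
  vanishes = trans (cong (λ z → P x ∧ α z) (ℕ.m+[n∸m]≡n i≤x))
    (trans (P∧α {x} ℕ.≤-refl) (cong fib (ℕ.n∸n≡0 x)))

-- Both sides in Fibonacci factorials.

-- Each fibonomial is a quotient of Fibonacci factorials; the powers of `fib! d` from numerators and
-- denominators cancel.
fiboHoggatt-fib! : ∀ d m N → m ≤ N →
  fiboHoggatt d (suc N) (suc m)
      * (prod (suc m) (λ j → fib! (N ∸ j)) * prod (suc m) (λ j → fib! (m ∸ j +ℕ d)))
    ≡ prod (suc m) (λ j → fib! (N ∸ j +ℕ d)) * prod (suc m) (λ j → fib! (m ∸ j))
fiboHoggatt-fib! d m N m≤N = begin
  H * (B * C)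
    ≡⟨ cong (λ z → H * (B * z)) (sym (binomials m)) ⟩
  H * (B * (den * (E * D)))
    ≡⟨ solve 5 (λ H B q E D → H :* (B :* (q :* (E :* D))) := H :* q :* (E :* B) :* D) refl H B den E D ⟩
  H * den * (E * B) * D
    ≡⟨ cong (λ z → z * (E * B) * D) H*den≡num ⟩
  num * (E * B) * D
    ≡⟨ cong (_* D) (binomials N) ⟩
  A * D ∎
  where
  k : ℕ
  k = suc m
  H A B C D E num den : ℚ
  H = fiboHoggatt d (suc N) (suc m)
  A = prod k (λ j → fib! (N ∸ j +ℕ d))
  B = prod k (λ j → fib! (N ∸ j))
  C = prod k (λ j → fib! (m ∸ j +ℕ d))
  D = prod k (λ j → fib! (m ∸ j))
  E = prod k (λ _ → fib! d)
  num = prod k (λ j → fibonomial (N ∸ j +ℕ d) d)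
  den = prod k (λ j → fibonomial (m ∸ j +ℕ d) d)
  binomials : ∀ M →
    prod k (λ j → fibonomial (M ∸ j +ℕ d) d) * (E * prod k (λ j → fib! (M ∸ j)))
      ≡ prod k (λ j → fib! (M ∸ j +ℕ d))
  binomials M = begin
    prod k b * (E * prod k (λ j → fib! (M ∸ j)))
      ≡⟨ cong (prod k b *_) (sym (prod-* k (λ _ → fib! d) (λ j → fib! (M ∸ j)))) ⟩
    prod k b * prod k (λ j → fib! d * fib! (M ∸ j))
      ≡⟨ sym (prod-* k b (λ j → fib! d * fib! (M ∸ j))) ⟩
    prod k (λ j → b j * (fib! d * fib! (M ∸ j)))
      ≡⟨ prod-cong k (λ j _ → fibonomial-fib! (M ∸ j) d) ⟩
    prod k (λ j → fib! (M ∸ j +ℕ d)) ∎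
    where
    b : ℕ → ℚ
    b j = fibonomial (M ∸ j +ℕ d) d
  pred-suc : ∀ {j M} → j ≤ M → suc M ∸ j +ℕ d ∸ 1 ≡ M ∸ j +ℕ d
  pred-suc j≤M = cong (λ z → z +ℕ d ∸ 1) (ℕ.+-∸-assoc 1 j≤M)
  H*den≡num : H * den ≡ num
  H*den≡num = begin
    H * den
      ≡⟨ cong (_* den) (prod-cong k (λ j j<k → cong₂ (λ y z → fibonomial y d /' fibonomial z d)
           (pred-suc (ℕ.≤-trans (ℕ.s≤s⁻¹ j<k) m≤N)) (pred-suc (ℕ.s≤s⁻¹ j<k)))) ⟩
    prod k (λ j → fibonomial (N ∸ j +ℕ d) d /' fibonomial (m ∸ j +ℕ d) d) * den
      ≡⟨ prod-/' k _ _ (λ j _ → fibonomial-≢0 (m ∸ j) d) ⟩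
    num ∎

-- The multiplier and the products on the right are those of `fiboHoggatt-fib!`, so the two results
-- can be compared directly. Here `r`, which is n - k, counts the forms that all rows share.
det-fib! : ∀ d m r → let k = suc m; N = m +ℕ r in
  det k (λ i j → fibonomial (N +ℕ d +ℕ toℕ j ∸ toℕ i) N)
      * (prod k (λ j → fib! (N ∸ j)) * prod k (λ j → fib! (m ∸ j +ℕ d)))
    ≡ negOnePow (d *ℕ (k C 2))
        * (prod k (λ j → fib! (N ∸ j +ℕ d)) * prod k (λ j → fib! (m ∸ j)))
-- `Q` clears the denominator `fib! N` from every column and reappears in the value of `K * B`.
det-fib! d m r = *-cancelˡ-≢0 Q (prod-≢0 k (λ _ → fib!-≢0 N)) (begin
  Q * (Δ * (B * C′))
    ≡⟨ solve 4 (λ Q Δ B C′ → Q :* (Δ :* (B :* C′)) := Q :* Δ :* (B :* C′)) refl Q Δ B C′ ⟩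
  Q * Δ * (B * C′)
    ≡⟨ cong (_* (B * C′)) Q*Δ≡ ⟩
  G * (V * K) * (B * C′)
    ≡⟨ solve 5 (λ G V K B C′ → G :* (V :* K) :* (B :* C′) := G :* C′ :* V :* (K :* B)) refl G V K B C′ ⟩
  G * C′ * V * (K * B)
    ≡⟨ cong₂ _*_ (cong₂ _*_ G*C′≡A V≡) K*B≡ ⟩
  A * (σ₁ * D) * (σ₀ * Q)
    ≡⟨ solve 5 (λ A σ₁ D σ₀ Q → A :* (σ₁ :* D) :* (σ₀ :* Q) := Q :* (σ₁ :* σ₀ :* (A :* D))) refl A σ₁ D σ₀ Q ⟩
  Q * (σ₁ * σ₀ * (A * D))
    -- The Vandermonde sign starts at N + d and the other at N; the offset `d` produces the sign of
    -- the theorem.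
    ≡⟨ cong (λ z → Q * (z * (A * D))) (staircaseSign-* k N d) ⟩
  Q * (negOnePow (d *ℕ (k C 2)) * (A * D)) ∎)
  where
  k N : ℕ
  k = suc m
  N = m +ℕ r
  x : ℕ → ℕ
  x j = N +ℕ d +ℕ j
  N≤x : ∀ j → N ≤ x j
  N≤x j = ℕ.≤-trans (ℕ.m≤m+n N d) (ℕ.m≤m+n (N +ℕ d) j)
  β : ℕ → ℚ × ℚ
  β s = α (N +ℕ s)
  p : Fin k → ℚ × ℚ
  p j = P (x (toℕ j))
  γ : ℕ → ℚ
  γ j = prod r (λ t → P (x j) ∧ α (m +ℕ t))
  Δ A B C′ D Q G V K σ₀ σ₁ : ℚ
  Δ = det k (λ i j → fibonomial (x (toℕ j) ∸ toℕ i) N)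
  A = prod k (λ j → fib! (N ∸ j +ℕ d))
  B = prod k (λ j → fib! (N ∸ j))
  C′ = prod k (λ j → fib! (m ∸ j +ℕ d))
  D = prod k (λ j → fib! (m ∸ j))
  Q = prod k (λ _ → fib! N)
  G = prod k γ
  V = vandermonde k p
  K = krattenthalerFactor m α β
  σ₀ = staircaseSign k N
  σ₁ = staircaseSign k (N +ℕ d)
  Q*Δ≡ : Q * Δ ≡ G * (V * K)
  Q*Δ≡ = begin
    Q * Δ
      ≡⟨ cong (_* Δ) (sym (prodFin-toℕ k (λ _ → fib! N))) ⟩
    prodFin k (λ _ → fib! N) * Δ
      ≡⟨ sym (det-scaleColumns k (λ _ → fib! N) (λ i j → fibonomial (x (toℕ j) ∸ toℕ i) N)) ⟩
    det k (λ i j → fib! N * fibonomial (x (toℕ j) ∸ toℕ i) N)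
      ≡⟨ det-cong k (λ i j → trans
           (fibonomial-linearForms N (ℕ.≤-trans (toℕ≤pred[n] i) (ℕ.≤-trans (ℕ.m≤m+n m r) (N≤x (toℕ j)))))
           (sym (krattenthalerEntry-window m r i α (p j)))) ⟩
    det k (λ i j → γ (toℕ j) * krattenthalerEntry m i α β (p j))
      ≡⟨ det-scaleColumns k (γ ∘ toℕ) (λ i j → krattenthalerEntry m i α β (p j)) ⟩
    prodFin k (γ ∘ toℕ) * det k (λ i j → krattenthalerEntry m i α β (p j))
      ≡⟨ cong₂ _*_ (prodFin-toℕ k γ) (krattenthaler m α β p) ⟩
    G * (V * K) ∎
  V≡ : V ≡ σ₁ * D
  V≡ = trans (vandermonde-P k (N +ℕ d) (λ _ → refl)) (cong (σ₁ *_) (prod-reverse m fib!))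
  K*B≡ : K * B ≡ σ₀ * Q
  K*B≡ = krattenthalerFactor-fib! m N N (ℕ.m≤m+n m r) (λ _ _ s≤N+t → α∧α s≤N+t)
  -- The common factor of column `j` is a falling product of length `r` from F(r + j + d).
  column : ∀ j → γ j * fib! (j +ℕ d) ≡ fib! (r +ℕ j +ℕ d)
  column j = begin
    γ j * fib! (j +ℕ d)
      ≡⟨ cong₂ _*_
           (prod-cong r (λ t t<r → trans (P∧α (ℕ.≤-trans (ℕ.+-monoʳ-≤ m (ℕ.<⇒≤ t<r)) (N≤x j)))
             (cong fib (trans (sym (ℕ.∸-+-assoc (x j) m t)) (cong (_∸ t) x∸m≡)))))
           (cong fib! (sym (trans (cong (_∸ r) (ℕ.+-assoc r j d)) (ℕ.m+n∸m≡n r (j +ℕ d))))) ⟩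
    prod r (λ t → fib (r +ℕ j +ℕ d ∸ t)) * fib! (r +ℕ j +ℕ d ∸ r)
      ≡⟨ fib!-falling r (ℕ.≤-trans (ℕ.m≤m+n r j) (ℕ.m≤m+n (r +ℕ j) d)) ⟩
    fib! (r +ℕ j +ℕ d) ∎
    where
    x≡ : x j ≡ m +ℕ (r +ℕ j +ℕ d)
    x≡ = trans (ℕ.+-assoc N d j) (trans (ℕ.+-assoc m r (d +ℕ j))
      (cong (m +ℕ_) (trans (cong (r +ℕ_) (ℕ.+-comm d j)) (sym (ℕ.+-assoc r j d)))))
    x∸m≡ : x j ∸ m ≡ r +ℕ j +ℕ d
    x∸m≡ = trans (cong (_∸ m) x≡) (ℕ.m+n∸m≡n m (r +ℕ j +ℕ d))
  G*C′≡A : G * C′ ≡ A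
  G*C′≡A = begin
    G * C′
      ≡⟨ cong (G *_) (sym (prod-reverse m (λ j → fib! (j +ℕ d)))) ⟩
    G * prod k (λ j → fib! (j +ℕ d))
      ≡⟨ sym (prod-* k γ (λ j → fib! (j +ℕ d))) ⟩
    prod k (λ j → γ j * fib! (j +ℕ d))
      ≡⟨ prod-cong k (λ j _ → column j) ⟩
    prod k (λ j → fib! (r +ℕ j +ℕ d))
      ≡⟨ prod-reverse m (λ j → fib! (r +ℕ j +ℕ d)) ⟩
    prod k (λ j → fib! (r +ℕ (m ∸ j) +ℕ d))
      ≡⟨ prod-cong k (λ j j<k → cong (λ z → fib! (z +ℕ d))
           (trans (sym (ℕ.+-∸-assoc r (ℕ.s≤s⁻¹ j<k))) (cong (_∸ j) (ℕ.+-comm r m)))) ⟩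
    A ∎

theorem13 : (d n k : ℕ) → .{{NonZero d}} → .{{NonZero n}} → k ≤ n →
    fiboHoggatt d n k
    ≡ negOnePow (d *ℕ (k C 2))
    * det k (λ i j → fibonomial ((n +ℕ d +ℕ toℕ j) ∸ (toℕ i +ℕ 1)) (n ∸ 1))
theorem13 d n zero _ = sym (trans (*-identityʳ _) (cong negOnePow (ℕ.*-zeroʳ d)))
theorem13 d (suc N) (suc m) (s≤s m≤N) = *-cancelˡ-≢0 R R≢0 (begin
  R * H
    ≡⟨ *-comm R H ⟩
  H * R
    ≡⟨ fiboHoggatt-fib! d m N m≤N ⟩
  T
    ≡⟨ sym (*-identityˡ T) ⟩
  1ℚ * T
    -- The sign is its own inverse, so it moves from the value of the determinant to the other side.
    ≡⟨ cong (_* T) (sym (negOnePow-square (d *ℕ (suc m C 2)))) ⟩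
  σ * σ * T
    ≡⟨ *-assoc σ σ T ⟩
  σ * (σ * T)
    ≡⟨ cong (σ *_) (sym Δ*R≡) ⟩
  σ * (Δ * R)
    ≡⟨ solve 3 (λ σ Δ R → σ :* (Δ :* R) := R :* (σ :* Δ)) refl σ Δ R ⟩
  R * (σ * Δ)
    -- With n = N + 1, subtracting 1 + i reduces by computation to subtracting i from N + d + j.
    ≡⟨ cong (λ z → R * (σ * z)) (det-cong (suc m) (λ i j →
         cong (λ z → fibonomial (suc N +ℕ d +ℕ toℕ j ∸ z) N) (ℕ.+-comm 1 (toℕ i)))) ⟩
  R * (σ * det (suc m) (λ i j → fibonomial (suc N +ℕ d +ℕ toℕ j ∸ (toℕ i +ℕ 1)) N)) ∎)
  where
  H Δ σ R T : ℚ
  H = fiboHoggatt d (suc N) (suc m)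
  Δ = det (suc m) (λ i j → fibonomial (N +ℕ d +ℕ toℕ j ∸ toℕ i) N)
  σ = negOnePow (d *ℕ (suc m C 2))
  R = prod (suc m) (λ j → fib! (N ∸ j)) * prod (suc m) (λ j → fib! (m ∸ j +ℕ d))
  T = prod (suc m) (λ j → fib! (N ∸ j +ℕ d)) * prod (suc m) (λ j → fib! (m ∸ j))
  R≢0 : R ≢ 0ℚ
  R≢0 = *-≢0 (prod-≢0 (suc m) (λ j → fib!-≢0 (N ∸ j))) (prod-≢0 (suc m) (λ j → fib!-≢0 (m ∸ j +ℕ d)))
  Δ*R≡ : Δ * R ≡ σ * T
  Δ*R≡ = subst
    (λ M → det (suc m) (λ i j → fibonomial (M +ℕ d +ℕ toℕ j ∸ toℕ i) M)
        * (prod (suc m) (λ j → fib! (M ∸ j)) * prod (suc m) (λ j → fib! (m ∸ j +ℕ d)))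
      ≡ σ * (prod (suc m) (λ j → fib! (M ∸ j +ℕ d)) * prod (suc m) (λ j → fib! (m ∸ j))))
    (ℕ.m+[n∸m]≡n m≤N) (det-fib! d m (N ∸ m))
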